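{- Let $\mathbb K$ be a field of characteristic $p>2$, $n,r\ge1$, $a,\kappa\in\mathbb K^\times$, $\Lambda_1,\dots,\Lambda_n\in\mathbb K$. The scalar $p$-curvature functions $\tilde\Phi_l(s,x)$, $l=1,\dots,r$, and $\tilde\Psi_m(s,x)$, $m=1,\dots,n$, are $a$-periodic in the variables $s=(s_1,\dots,s_r)$ and $x=(x_1,\dots,x_n)$; that is, these rational functions are unchanged when any one of the variables $s_1,\dots,s_r,x_1,\dots,x_n$ is increased by $a$.
   Context: Over $\mathbb K$ define $$\Phi_l(s,x)=\kappa\prod_{i=1}^n\frac{s_l-x_i+\Lambda_i}{s_l-x_i+a}\prod_{j\ne l}\frac{(s_l-s_j+a)(s_l-s_j-1)}{(s_l-s_j)(s_l-s_j+1+a)},\qquad \Psi_m(s,x)=\prod_{j=1}^r\frac{s_j-x_m}{s_j-x_m+\Lambda_m-a},$$ and $\tilde\Phi_l(s,x)=\prod_{i=0}^{p-1}\Phi_l(s+iae_l,x)$, $\tilde\Psi_m(s,x)=\prod_{i=0}^{p-1}\Psi_m(s,x+iaf_m)$, where $s+iae_l$ (resp. $x+iaf_m$) is $s$ (resp. $x$) with the $l$-th (resp. $m$-th) coordinate increased by $ia$. -}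

module Defs where

open import Level using (_⊔_)
open import Algebra.Apartness.Bundles using (HeytingField; HeytingCommutativeRing)
import Algebra.Apartness.Properties.HeytingCommutativeRing as HeytingProperties
open import Algebra.Bundles using (CommutativeRing; CommutativeMonoid)
import Algebra.Definitions.RawMonoid as RawMonoidDefinitions
import Algebra.Morphism.Construct.Composition as Composition
import Algebra.Morphism.Construct.Identity as Identity
open import Algebra.Morphism.Structures using (module RingMorphisms)
import Algebra.Properties.CommutativeSemigroup as CommutativeSemigroupProperties
import Algebra.Properties.Ring as RingProperties
open import Data.Empty using (⊥)
open import Data.Fin.Base using (Fin; zero; suc; toℕ; splitAt; _↑ˡ_; _↑ʳ_)
open import Data.Fin.Properties using (_≟_; ↑ˡ-injective; splitAt-↑ˡ; splitAt-↑ʳ)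
open import Data.List.Base using (List; []; _∷_; map)
open import Data.Nat.Base using (ℕ; zero; suc) renaming (_+_ to _+ℕ_)
open import Data.Nat.Divisibility using (_∣_)
open import Data.Product.Base using (_×_; _,_; proj₁)
open import Data.Vec.Functional using (Vector)
open import Function.Base using (_∘_; id)
open import Function.Bundles using (_⇔_)
open import Relation.Binary.PropositionalEquality as ≡ using (_≢_)
import Relation.Binary.Reasoning.Setoid as SetoidReasoning
open import Relation.Binary.Structures using (IsEquivalence)
open import Relation.Nullary.Decidable.Core using (yes; no)
open import Relation.Nullary.Negation.Core using (¬_; contradiction)

NoZeroDivisors : ∀ {c ℓ} → CommutativeRing c ℓ → Set (c ⊔ ℓ)
NoZeroDivisors R = ∀ {x y} → ¬ x ≈ 0# → ¬ y ≈ 0# → ¬ x * y ≈ 0#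
  where open CommutativeRing R

StableEquality : ∀ {c ℓ} → CommutativeRing c ℓ → Set (c ⊔ ℓ)
StableEquality R = ∀ {x y} → ¬ ¬ x ≈ y → x ≈ y
  where open CommutativeRing R

module _ {c₁ ℓ₁ c₂ ℓ₂} (A : CommutativeRing c₁ ℓ₁) (B : CommutativeRing c₂ ℓ₂) where
  open RingMorphisms (CommutativeRing.rawRing A) (CommutativeRing.rawRing B) using (IsRingHomomorphism)

  IsHom : (CommutativeRing.Carrier A → CommutativeRing.Carrier B) → Set (c₁ ⊔ ℓ₁ ⊔ ℓ₂)
  IsHom = IsRingHomomorphism

-- R[X]: coefficient lists, constant term first.  Trailing zeros are allowed,
-- and two lists are equal when all their coefficients agree.
module Univariate {c ℓ} (R : CommutativeRing c ℓ) where
  private module R = CommutativeRing R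
  open R using (Carrier; 0#; 1#)
  private module RP = RingProperties R.ring

  Poly : Set c
  Poly = List Carrier

  coeff : Poly → ℕ → Carrier
  coeff []      _       = 0#
  coeff (a ∷ f) zero    = a
  coeff (a ∷ f) (suc k) = coeff f k

  infix 4 _≈_
  record _≈_ (f g : Poly) : Set ℓ where
    constructor coeffwise
    field at : ∀ k → coeff f k R.≈ coeff g k
  open _≈_ public

  infixl 6 _+_
  infixl 7 _*_ _·_
  infix  8 -_

  _+_ : Poly → Poly → Poly
  []      + g       = g
  (a ∷ f) + []      = a ∷ f
  (a ∷ f) + (b ∷ g) = a R.+ b ∷ f + g

  -_ : Poly → Poly
  -_ = map (R.-_)

  _·_ : Carrier → Poly → Poly
  a · f = map (a R.*_) f

  _*_ : Poly → Poly → Poly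
  []      * g = []
  (a ∷ f) * g = a · g + (0# ∷ f * g)

  constant : Carrier → Poly
  constant a = a ∷ []

  X : Poly
  X = 0# ∷ 1# ∷ []

  coeff-+ : ∀ f g k → coeff (f + g) k R.≈ coeff f k R.+ coeff g k
  coeff-+ []      g       k       = R.sym (R.+-identityˡ _)
  coeff-+ (a ∷ f) []      k       = R.sym (R.+-identityʳ _)
  coeff-+ (a ∷ f) (b ∷ g) zero    = R.refl
  coeff-+ (a ∷ f) (b ∷ g) (suc k) = coeff-+ f g k

  coeff-neg : ∀ f k → coeff (- f) k R.≈ R.- coeff f k
  coeff-neg []      k       = R.sym RP.-0#≈0#
  coeff-neg (a ∷ f) zero    = R.refl
  coeff-neg (a ∷ f) (suc k) = coeff-neg f k

  coeff-· : ∀ a f k → coeff (a · f) k R.≈ a R.* coeff f k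
  coeff-· a []      k       = R.sym (R.zeroʳ a)
  coeff-· a (b ∷ f) zero    = R.refl
  coeff-· a (b ∷ f) (suc k) = coeff-· a f k

  isEquivalence : IsEquivalence _≈_
  isEquivalence = record
    { refl  = coeffwise λ _ → R.refl
    ; sym   = λ p → coeffwise λ k → R.sym (at p k)
    ; trans = λ p q → coeffwise λ k → R.trans (at p k) (at q k)
    }

  open IsEquivalence isEquivalence public using () renaming (refl to ≈-refl; sym to ≈-sym; trans to ≈-trans)

  ∷-cong : ∀ {a b f g} → a R.≈ b → f ≈ g → a ∷ f ≈ b ∷ g
  ∷-cong p q = coeffwise λ { zero → p ; (suc k) → at q k }

  tail-cong : ∀ {a b f g} → a ∷ f ≈ b ∷ g → f ≈ g
  tail-cong p = coeffwise λ k → at p (suc k)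

  tail-zero : ∀ {a f} → a ∷ f ≈ [] → f ≈ []
  tail-zero p = coeffwise λ k → at p (suc k)

  0∷-zero : ∀ {a f} → a R.≈ 0# → f ≈ [] → a ∷ f ≈ []
  0∷-zero p q = coeffwise λ { zero → p ; (suc k) → at q k }

  +-cong : ∀ {f f′ g g′} → f ≈ f′ → g ≈ g′ → f + g ≈ f′ + g′
  +-cong {f} {f′} {g} {g′} p q = coeffwise λ k →
    R.trans (coeff-+ f g k) (R.trans (R.+-cong (at p k) (at q k)) (R.sym (coeff-+ f′ g′ k)))

  +-assoc : ∀ f g h → (f + g) + h ≈ f + (g + h)
  +-assoc f g h = coeffwise λ k → begin
    coeff ((f + g) + h) k                     ≈⟨ coeff-+ (f + g) h k ⟩
    coeff (f + g) k R.+ coeff h k             ≈⟨ R.+-congʳ (coeff-+ f g k) ⟩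
    (coeff f k R.+ coeff g k) R.+ coeff h k   ≈⟨ R.+-assoc _ _ _ ⟩
    coeff f k R.+ (coeff g k R.+ coeff h k)   ≈⟨ R.+-congˡ (coeff-+ g h k) ⟨
    coeff f k R.+ coeff (g + h) k             ≈⟨ coeff-+ f (g + h) k ⟨
    coeff (f + (g + h)) k                     ∎
    where open SetoidReasoning R.setoid

  +-comm : ∀ f g → f + g ≈ g + f
  +-comm f g = coeffwise λ k →
    R.trans (coeff-+ f g k) (R.trans (R.+-comm _ _) (R.sym (coeff-+ g f k)))

  +-identityʳ : ∀ f → f + [] ≈ f
  +-identityʳ f = +-comm f []

  neg-cong : ∀ {f g} → f ≈ g → - f ≈ - g
  neg-cong {f} {g} p = coeffwise λ k →
    R.trans (coeff-neg f k) (R.trans (R.-‿cong (at p k)) (R.sym (coeff-neg g k)))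

  neg-inverseˡ : ∀ f → - f + f ≈ []
  neg-inverseˡ f = coeffwise λ k →
    R.trans (coeff-+ (- f) f k) (R.trans (R.+-congʳ (coeff-neg f k)) (R.-‿inverseˡ _))

  neg-inverseʳ : ∀ f → f + - f ≈ []
  neg-inverseʳ f = ≈-trans (+-comm f (- f)) (neg-inverseˡ f)

  +-commutativeMonoid : CommutativeMonoid c ℓ
  +-commutativeMonoid = record
    { isCommutativeMonoid = record
      { isMonoid = record
        { isSemigroup = record
          { isMagma = record { isEquivalence = isEquivalence ; ∙-cong = +-cong }
          ; assoc   = +-assoc
          }
        ; identity = (λ _ → ≈-refl) , +-identityʳ
        }
      ; comm = +-comm
      }
    }

  private
    module + = CommutativeMonoid +-commutativeMonoid
    open CommutativeSemigroupProperties +.commutativeSemigroup using (interchange; x∙yz≈y∙xz)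
    open SetoidReasoning +.setoid

  ·-cong : ∀ {a b f g} → a R.≈ b → f ≈ g → a · f ≈ b · g
  ·-cong {a} {b} {f} {g} p q = coeffwise λ k →
    R.trans (coeff-· a f k) (R.trans (R.*-cong p (at q k)) (R.sym (coeff-· b g k)))

  ·-distribˡ : ∀ a f g → a · (f + g) ≈ a · f + a · g
  ·-distribˡ a []      g       = ≈-refl
  ·-distribˡ a (b ∷ f) []      = ≈-refl
  ·-distribˡ a (b ∷ f) (d ∷ g) = ∷-cong (R.distribˡ a b d) (·-distribˡ a f g)

  ·-distribʳ : ∀ a b f → (a R.+ b) · f ≈ a · f + b · f
  ·-distribʳ a b []      = ≈-refl
  ·-distribʳ a b (d ∷ f) = ∷-cong (R.distribʳ d a b) (·-distribʳ a b f)

  ·-assoc : ∀ a b f → (a R.* b) · f ≈ a · (b · f)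
  ·-assoc a b []      = ≈-refl
  ·-assoc a b (d ∷ f) = ∷-cong (R.*-assoc a b d) (·-assoc a b f)

  ·-identity : ∀ f → 1# · f ≈ f
  ·-identity []      = ≈-refl
  ·-identity (a ∷ f) = ∷-cong (R.*-identityˡ a) (·-identity f)

  ·-zero : ∀ f → 0# · f ≈ []
  ·-zero []      = ≈-refl
  ·-zero (a ∷ f) = 0∷-zero (R.zeroˡ a) (·-zero f)

  0∷-+ : ∀ f g → 0# ∷ (f + g) ≈ (0# ∷ f) + (0# ∷ g)
  0∷-+ f g = ∷-cong (R.sym (R.+-identityˡ 0#)) ≈-refl

  0∷-* : ∀ f g → (0# ∷ f) * g ≈ 0# ∷ f * g
  0∷-* f g = +-cong (·-zero g) ≈-refl

  ·-0∷ : ∀ a f → a · (0# ∷ f) ≈ 0# ∷ a · f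
  ·-0∷ a f = ∷-cong (R.zeroʳ a) ≈-refl

  *-zeroʳ : ∀ f → f * [] ≈ []
  *-zeroʳ []      = ≈-refl
  *-zeroʳ (a ∷ f) = 0∷-zero R.refl (*-zeroʳ f)

  *-zero : ∀ {f} g → f ≈ [] → f * g ≈ []
  *-zero {[]}    g p = ≈-refl
  *-zero {a ∷ f} g p = begin
    a · g + (0# ∷ f * g) ≈⟨ +-cong (≈-trans (·-cong (at p 0) ≈-refl) (·-zero g)) (0∷-zero R.refl (*-zero g (tail-zero p))) ⟩
    []                   ∎

  *-cong : ∀ {f f′ g g′} → f ≈ f′ → g ≈ g′ → f * g ≈ f′ * g′
  *-cong {[]}    {f′}     {g} {g′} p q = ≈-sym (*-zero g′ (≈-sym p))
  *-cong {a ∷ f} {[]}     {g} {g′} p q = *-zero g p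
  *-cong {a ∷ f} {b ∷ f′} {g} {g′} p q =
    +-cong (·-cong (at p 0) q) (∷-cong R.refl (*-cong (tail-cong p) q))

  *-distribʳ : ∀ h f g → (f + g) * h ≈ f * h + g * h
  *-distribʳ h []      g       = ≈-refl
  *-distribʳ h (a ∷ f) []      = ≈-sym (+-identityʳ _)
  *-distribʳ h (a ∷ f) (b ∷ g) = begin
    (a R.+ b) · h + (0# ∷ (f + g) * h)
      ≈⟨ +-cong (·-distribʳ a b h) (≈-trans (∷-cong R.refl (*-distribʳ h f g)) (0∷-+ (f * h) (g * h))) ⟩
    (a · h + b · h) + ((0# ∷ f * h) + (0# ∷ g * h))
      ≈⟨ interchange (a · h) (b · h) (0# ∷ f * h) (0# ∷ g * h) ⟩
    (a · h + (0# ∷ f * h)) + (b · h + (0# ∷ g * h)) ∎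

  ·-* : ∀ a f g → (a · f) * g ≈ a · (f * g)
  ·-* a []      g = ≈-refl
  ·-* a (b ∷ f) g = begin
    (a R.* b) · g + (0# ∷ (a · f) * g)
      ≈⟨ +-cong (·-assoc a b g) (≈-trans (∷-cong R.refl (·-* a f g)) (≈-sym (·-0∷ a _))) ⟩
    a · (b · g) + a · (0# ∷ f * g)
      ≈⟨ ·-distribˡ a (b · g) (0# ∷ f * g) ⟨
    a · (b · g + (0# ∷ f * g)) ∎

  *-assoc : ∀ f g h → (f * g) * h ≈ f * (g * h)
  *-assoc []      g h = ≈-refl
  *-assoc (a ∷ f) g h = begin
    (a · g + (0# ∷ f * g)) * h
      ≈⟨ *-distribʳ h (a · g) (0# ∷ f * g) ⟩
    (a · g) * h + (0# ∷ f * g) * h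
      ≈⟨ +-cong (·-* a g h) (≈-trans (0∷-* (f * g) h) (∷-cong R.refl (*-assoc f g h))) ⟩
    a · (g * h) + (0# ∷ f * (g * h)) ∎

  *-∷ : ∀ f b g → f * (b ∷ g) ≈ b · f + (0# ∷ f * g)
  *-∷ []      b g = ≈-sym (0∷-zero R.refl ≈-refl)
  *-∷ (a ∷ f) b g = ∷-cong (R.+-congʳ (R.*-comm a b)) (begin
    a · g + f * (b ∷ g)             ≈⟨ +-cong ≈-refl (*-∷ f b g) ⟩
    a · g + (b · f + (0# ∷ f * g))  ≈⟨ x∙yz≈y∙xz (a · g) (b · f) (0# ∷ f * g) ⟩
    b · f + (a · g + (0# ∷ f * g))  ∎)

  *-comm : ∀ f g → f * g ≈ g * f
  *-comm []      g = ≈-sym (*-zeroʳ g)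
  *-comm (a ∷ f) g = ≈-trans (+-cong ≈-refl (∷-cong R.refl (*-comm f g))) (≈-sym (*-∷ g a f))

  constant-* : ∀ a f → constant a * f ≈ a · f
  constant-* a f = ≈-trans (+-cong ≈-refl (0∷-zero R.refl ≈-refl)) (+-identityʳ _)

  *-identityˡ : ∀ f → constant 1# * f ≈ f
  *-identityˡ f = ≈-trans (constant-* 1# f) (·-identity f)

  *-distribˡ : ∀ h f g → h * (f + g) ≈ h * f + h * g
  *-distribˡ h f g = begin
    h * (f + g)   ≈⟨ *-comm h (f + g) ⟩
    (f + g) * h   ≈⟨ *-distribʳ h f g ⟩
    f * h + g * h ≈⟨ +-cong (*-comm f h) (*-comm g h) ⟩
    h * f + h * g ∎

  commutativeRing : CommutativeRing c ℓ
  commutativeRing = record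
    { Carrier = Poly ; _≈_ = _≈_ ; _+_ = _+_ ; _*_ = _*_ ; -_ = -_ ; 0# = [] ; 1# = constant 1#
    ; isCommutativeRing = record
      { isRing = record
        { +-isAbelianGroup = record
          { isGroup = record
            { isMonoid = +.isMonoid
            ; inverse  = neg-inverseˡ , neg-inverseʳ
            ; ⁻¹-cong  = neg-cong
            }
          ; comm = +-comm
          }
        ; *-cong     = *-cong
        ; *-assoc    = *-assoc
        ; *-identity = *-identityˡ , λ f → ≈-trans (*-comm f _) (*-identityˡ f)
        ; distrib    = *-distribˡ , *-distribʳ
        }
      ; *-comm = *-comm
      }
    }

  X* : ∀ f → X * f ≈ 0# ∷ f
  X* f = ≈-trans (0∷-* (constant 1#) f) (∷-cong R.refl (*-identityˡ f))

  constant+X* : ∀ a f → a ∷ f ≈ constant a + X * f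
  constant+X* a f = ≈-trans (∷-cong (R.sym (R.+-identityʳ a)) ≈-refl)
                            (+-cong {constant a} ≈-refl (≈-sym (X* f)))

  constant-isHom : IsHom R commutativeRing constant
  constant-isHom = record
    { isSemiringHomomorphism = record
      { isNearSemiringHomomorphism = record
        { +-isMonoidHomomorphism = record
          { isMagmaHomomorphism = record
            { isRelHomomorphism = record { cong = λ p → ∷-cong p ≈-refl }
            ; homo = λ _ _ → ≈-refl
            }
          ; ε-homo = 0∷-zero R.refl ≈-refl
          }
        ; *-homo = λ a b → ≈-sym (constant-* a (constant b))
        }
      ; 1#-homo = ≈-refl
      }
    ; -‿homo = λ _ → ≈-refl
    }

  noZeroDivisors : NoZeroDivisors R → NoZeroDivisors commutativeRing
  noZeroDivisors nzd {f} {g} f≉0 g≉0 fg≈0 = go f g f≉0 g≉0 fg≈0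
    where
    lowerˡ : ∀ a f g → a R.≈ 0# → (a ∷ f) * g ≈ 0# ∷ f * g
    lowerˡ a f g a≈0 = +-cong (≈-trans (·-cong a≈0 ≈-refl) (·-zero g)) ≈-refl

    lowerʳ : ∀ f b g → b R.≈ 0# → f * (b ∷ g) ≈ 0# ∷ f * g
    lowerʳ f b g b≈0 = ≈-trans (*-∷ f b g) (+-cong (≈-trans (·-cong b≈0 ≈-refl) (·-zero f)) ≈-refl)

    go : ∀ f g → ¬ f ≈ [] → ¬ g ≈ [] → ¬ f * g ≈ []
    go []      g       f≉0 g≉0 fg≈0 = f≉0 ≈-refl
    go (a ∷ f) []      f≉0 g≉0 fg≈0 = g≉0 ≈-refl
    go (a ∷ f) (b ∷ g) f≉0 g≉0 fg≈0 = nzd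
      (λ a≈0 → go f (b ∷ g) (λ p → f≉0 (0∷-zero a≈0 p)) g≉0
                  (tail-zero (≈-trans (≈-sym (lowerˡ a f (b ∷ g) a≈0)) fg≈0)))
      (λ b≈0 → go (a ∷ f) g f≉0 (λ p → g≉0 (0∷-zero b≈0 p))
                  (tail-zero (≈-trans (≈-sym (lowerʳ (a ∷ f) b g b≈0)) fg≈0)))
      (R.trans (R.sym (R.+-identityʳ _)) (at fg≈0 0))

  stableEquality : StableEquality R → StableEquality commutativeRing
  stableEquality st p = coeffwise λ k → st λ q → p λ r → q (at r k)

-- The homomorphism R[X] → A extending φ and sending X to α.
module Evaluation {c ℓ c′ ℓ′} (R : CommutativeRing c ℓ) (A : CommutativeRing c′ ℓ′)
                  (φ : CommutativeRing.Carrier R → CommutativeRing.Carrier A)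
                  (α : CommutativeRing.Carrier A) where
  private module R = CommutativeRing R
  open R using (0#; 1#)
  open Univariate R
  private
    module A = CommutativeRing A
    module AP = RingProperties A.ring

  eval : Poly → A.Carrier
  eval []      = A.0#
  eval (a ∷ f) = φ a A.+ α A.* eval f

  module _ (φ-isHom : IsHom R A φ) where
    private
      module φ = RingMorphisms.IsRingHomomorphism φ-isHom
      open CommutativeSemigroupProperties (CommutativeRing.+-commutativeSemigroup A) using () renaming (interchange to +-interchange)
      open CommutativeSemigroupProperties (CommutativeRing.*-commutativeSemigroup A) using () renaming (x∙yz≈y∙xz to *-leftComm)
      open SetoidReasoning A.setoid

    eval-zero : ∀ f → f ≈ [] → eval f A.≈ A.0#
    eval-zero []      p = A.refl
    eval-zero (a ∷ f) p = begin
      φ a A.+ α A.* eval f  ≈⟨ A.+-cong (A.trans (φ.⟦⟧-cong (at p 0)) φ.0#-homo) (A.*-congˡ (eval-zero f (tail-zero p))) ⟩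
      A.0# A.+ α A.* A.0#   ≈⟨ A.+-identityˡ _ ⟩
      α A.* A.0#            ≈⟨ A.zeroʳ α ⟩
      A.0#                  ∎

    eval-cong : ∀ {f g} → f ≈ g → eval f A.≈ eval g
    eval-cong {[]}    {g}     p = A.sym (eval-zero g (≈-sym p))
    eval-cong {a ∷ f} {[]}    p = eval-zero (a ∷ f) p
    eval-cong {a ∷ f} {b ∷ g} p = A.+-cong (φ.⟦⟧-cong (at p 0)) (A.*-congˡ (eval-cong (tail-cong p)))

    eval-+ : ∀ f g → eval (f + g) A.≈ eval f A.+ eval g
    eval-+ []      g       = A.sym (A.+-identityˡ _)
    eval-+ (a ∷ f) []      = A.sym (A.+-identityʳ _)
    eval-+ (a ∷ f) (b ∷ g) = begin
      φ (a R.+ b) A.+ α A.* eval (f + g)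
        ≈⟨ A.+-cong (φ.+-homo a b) (A.trans (A.*-congˡ (eval-+ f g)) (A.distribˡ _ _ _)) ⟩
      (φ a A.+ φ b) A.+ (α A.* eval f A.+ α A.* eval g)
        ≈⟨ +-interchange (φ a) (φ b) (α A.* eval f) (α A.* eval g) ⟩
      (φ a A.+ α A.* eval f) A.+ (φ b A.+ α A.* eval g) ∎

    eval-· : ∀ a f → eval (a · f) A.≈ φ a A.* eval f
    eval-· a []      = A.sym (A.zeroʳ _)
    eval-· a (b ∷ f) = begin
      φ (a R.* b) A.+ α A.* eval (a · f)
        ≈⟨ A.+-cong (φ.*-homo a b) (A.trans (A.*-congˡ (eval-· a f)) (*-leftComm α (φ a) (eval f))) ⟩
      φ a A.* φ b A.+ φ a A.* (α A.* eval f)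
        ≈⟨ A.distribˡ _ _ _ ⟨
      φ a A.* (φ b A.+ α A.* eval f) ∎

    eval-0∷ : ∀ f → eval (0# ∷ f) A.≈ α A.* eval f
    eval-0∷ f = A.trans (A.+-congʳ φ.0#-homo) (A.+-identityˡ _)

    eval-* : ∀ f g → eval (f * g) A.≈ eval f A.* eval g
    eval-* []      g = A.sym (A.zeroˡ _)
    eval-* (a ∷ f) g = begin
      eval (a · g + (0# ∷ f * g))
        ≈⟨ eval-+ (a · g) (0# ∷ f * g) ⟩
      eval (a · g) A.+ eval (0# ∷ f * g)
        ≈⟨ A.+-cong (eval-· a g) (A.trans (eval-0∷ (f * g)) (A.*-congˡ (eval-* f g))) ⟩
      φ a A.* eval g A.+ α A.* (eval f A.* eval g)
        ≈⟨ A.+-congˡ (A.*-assoc _ _ _) ⟨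
      φ a A.* eval g A.+ (α A.* eval f) A.* eval g
        ≈⟨ A.distribʳ _ _ _ ⟨
      (φ a A.+ α A.* eval f) A.* eval g ∎

    eval-neg : ∀ f → eval (- f) A.≈ A.- eval f
    eval-neg f = AP.+-inverseˡ-unique _ _
      (A.trans (A.sym (eval-+ (- f) f)) (eval-zero (- f + f) (neg-inverseˡ f)))

    eval-constant : ∀ a → eval (constant a) A.≈ φ a
    eval-constant a = A.trans (A.+-congˡ (A.zeroʳ α)) (A.+-identityʳ _)

    eval-X : eval X A.≈ α
    eval-X = A.trans (eval-0∷ (constant 1#))
      (A.trans (A.*-congˡ (A.trans (eval-constant 1#) φ.1#-homo)) (A.*-identityʳ α))

    eval-isHom : IsHom commutativeRing A eval
    eval-isHom = record
      { isSemiringHomomorphism = record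
        { isNearSemiringHomomorphism = record
          { +-isMonoidHomomorphism = record
            { isMagmaHomomorphism = record
              { isRelHomomorphism = record { cong = eval-cong }
              ; homo = eval-+
              }
            ; ε-homo = A.refl
            }
          ; *-homo = eval-*
          }
        ; 1#-homo = A.trans (eval-constant 1#) φ.1#-homo
        }
      ; -‿homo = eval-neg
      }

  eval-unique : ∀ h → IsHom commutativeRing A h → (∀ a → h (constant a) A.≈ φ a) → h X A.≈ α →
                ∀ f → h f A.≈ eval f
  eval-unique h h-isHom hc hX = go
    where
    module h = RingMorphisms.IsRingHomomorphism h-isHom
    open SetoidReasoning A.setoid
    go : ∀ f → h f A.≈ eval f
    go []      = h.0#-homo
    go (a ∷ f) = begin
      h (a ∷ f)                   ≈⟨ h.⟦⟧-cong (constant+X* a f) ⟩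
      h (constant a + X * f)      ≈⟨ h.+-homo _ _ ⟩
      h (constant a) A.+ h (X * f) ≈⟨ A.+-cong (hc a) (h.*-homo X f) ⟩
      φ a A.+ h X A.* h f         ≈⟨ A.+-congˡ (A.*-cong hX (go f)) ⟩
      φ a A.+ α A.* eval f        ∎

-- K[z₀,…,z_{N-1}], built by adjoining one variable at a time.
module Multivariate {c ℓ} (K : CommutativeRing c ℓ) where
  private module K = CommutativeRing K

  Poly : ℕ → CommutativeRing c ℓ
  Poly zero    = K
  Poly (suc N) = Univariate.commutativeRing (Poly N)

  const : ∀ N → K.Carrier → CommutativeRing.Carrier (Poly N)
  const zero    a = a
  const (suc N) a = Univariate.constant (Poly N) (const N a)

  var : ∀ N → Fin N → CommutativeRing.Carrier (Poly N)
  var (suc N) zero    = Univariate.X (Poly N)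
  var (suc N) (suc i) = Univariate.constant (Poly N) (var N i)

  private
    _∘-isHom_ : ∀ {a₁ b₁ a₂ b₂ a₃ b₃} {A : CommutativeRing a₁ b₁} {B : CommutativeRing a₂ b₂} {C : CommutativeRing a₃ b₃}
                {f : CommutativeRing.Carrier A → CommutativeRing.Carrier B} {g : CommutativeRing.Carrier B → CommutativeRing.Carrier C} →
                IsHom B C g → IsHom A B f → IsHom A C (g ∘ f)
    _∘-isHom_ {C = C} g-isHom f-isHom = Composition.isRingHomomorphism (CommutativeRing.trans C) f-isHom g-isHom

    id-isHom : ∀ {a b} (A : CommutativeRing a b) → IsHom A A id
    id-isHom A = Identity.isRingHomomorphism (CommutativeRing.rawRing A) (CommutativeRing.refl A)

  const-isHom : ∀ N → IsHom K (Poly N) (const N)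
  const-isHom zero    = id-isHom K
  const-isHom (suc N) = _∘-isHom_ {A = K} {Poly N} {Poly (suc N)} (Univariate.constant-isHom (Poly N)) (const-isHom N)

  noZeroDivisors : NoZeroDivisors K → ∀ N → NoZeroDivisors (Poly N)
  noZeroDivisors nzd zero    = nzd
  noZeroDivisors nzd (suc N) = Univariate.noZeroDivisors (Poly N) (noZeroDivisors nzd N)

  stableEquality : StableEquality K → ∀ N → StableEquality (Poly N)
  stableEquality st zero    = st
  stableEquality st (suc N) = Univariate.stableEquality (Poly N) (stableEquality st N)

  module _ {c′ ℓ′} (A : CommutativeRing c′ ℓ′) (φ : K.Carrier → CommutativeRing.Carrier A) where
    private module A = CommutativeRing A

    eval : ∀ N → Vector A.Carrier N → CommutativeRing.Carrier (Poly N) → A.Carrier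
    eval zero    z = φ
    eval (suc N) z = Evaluation.eval (Poly N) A (eval N (z ∘ suc)) (z zero)

    eval-unique : ∀ N z h → IsHom (Poly N) A h → (∀ a → h (const N a) A.≈ φ a) →
                  (∀ i → h (var N i) A.≈ z i) → ∀ f → h f A.≈ eval N z f
    eval-unique zero    z h h-isHom hc hv = hc
    eval-unique (suc N) z h h-isHom hc hv =
      Evaluation.eval-unique (Poly N) A _ _ h h-isHom
        (eval-unique N (z ∘ suc) (h ∘ Univariate.constant (Poly N))
          (_∘-isHom_ {A = Poly N} {Poly (suc N)} {A} h-isHom (Univariate.constant-isHom (Poly N)))
          hc (hv ∘ suc))
        (hv zero)

    module _ (φ-isHom : IsHom K A φ) where

      eval-isHom : ∀ N z → IsHom (Poly N) A (eval N z)
      eval-isHom zero    z = φ-isHom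
      eval-isHom (suc N) z = Evaluation.eval-isHom (Poly N) A _ _ (eval-isHom N (z ∘ suc))

      eval-const : ∀ N z a → eval N z (const N a) A.≈ φ a
      eval-const zero    z a = A.refl
      eval-const (suc N) z a =
        A.trans (Evaluation.eval-constant (Poly N) A _ _ (eval-isHom N (z ∘ suc)) (const N a))
                (eval-const N (z ∘ suc) a)

      eval-var : ∀ N z i → eval N z (var N i) A.≈ z i
      eval-var (suc N) z zero    = Evaluation.eval-X (Poly N) A _ _ (eval-isHom N (z ∘ suc))
      eval-var (suc N) z (suc i) =
        A.trans (Evaluation.eval-constant (Poly N) A _ _ (eval-isHom N (z ∘ suc)) (var N i))
                (eval-var N (z ∘ suc) i)

  -- f(z) ↦ f(z + d)
  translate : ∀ N → Vector K.Carrier N → CommutativeRing.Carrier (Poly N) → CommutativeRing.Carrier (Poly N)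
  translate N d = eval (Poly N) (const N) N (λ i → var N i + const N (d i))
    where open CommutativeRing (Poly N) using (_+_)

  module _ (N : ℕ) where
    open CommutativeRing (Poly N)
    private module C = RingMorphisms.IsRingHomomorphism (const-isHom N)

    translate-isHom : ∀ d → IsHom (Poly N) (Poly N) (translate N d)
    translate-isHom d = eval-isHom (Poly N) (const N) (const-isHom N) N _

    translate-const : ∀ d a → translate N d (const N a) ≈ const N a
    translate-const d a = eval-const (Poly N) (const N) (const-isHom N) N _ a

    translate-var : ∀ d i → translate N d (var N i) ≈ var N i + const N (d i)
    translate-var d i = eval-var (Poly N) (const N) (const-isHom N) N _ i

    translate-inverse : ∀ d f → translate N (λ i → K.- d i) (translate N d f) ≈ f
    translate-inverse d f = trans
      (eval-unique (Poly N) (const N) N (var N) _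
        (_∘-isHom_ {A = Poly N} {Poly N} {Poly N} (translate-isHom d⁻) (translate-isHom d))
        (λ a → trans (d⁻.⟦⟧-cong (translate-const d a)) (translate-const d⁻ a))
        fixes-var f)
      (sym (eval-unique (Poly N) (const N) N (var N) id (id-isHom (Poly N)) (λ _ → refl) (λ _ → refl) f))
      where
      d⁻ : Vector K.Carrier N
      d⁻ i = K.- d i
      module d⁻ = RingMorphisms.IsRingHomomorphism (translate-isHom d⁻)
      open SetoidReasoning setoid
      fixes-var : ∀ i → translate N d⁻ (translate N d (var N i)) ≈ var N i
      fixes-var i = begin
        translate N d⁻ (translate N d (var N i))       ≈⟨ d⁻.⟦⟧-cong (translate-var d i) ⟩
        translate N d⁻ (var N i + const N (d i))       ≈⟨ d⁻.+-homo _ _ ⟩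
        translate N d⁻ (var N i) + translate N d⁻ (const N (d i))
                                                        ≈⟨ +-cong (translate-var d⁻ i) (translate-const d⁻ (d i)) ⟩
        (var N i + const N (K.- d i)) + const N (d i)   ≈⟨ +-assoc _ _ _ ⟩
        var N i + (const N (K.- d i) + const N (d i))   ≈⟨ +-congˡ (C.+-homo _ _) ⟨
        var N i + const N (K.- d i K.+ d i)             ≈⟨ +-congˡ (C.⟦⟧-cong (K.-‿inverseˡ (d i))) ⟩
        var N i + const N K.0#                          ≈⟨ +-congˡ C.0#-homo ⟩
        var N i + 0#                                    ≈⟨ +-identityʳ _ ⟩
        var N i                                         ∎

    translate-nonzero : ∀ d {f} → ¬ f ≈ 0# → ¬ translate N d f ≈ 0#
    translate-nonzero d {f} f≉0 p =
      f≉0 (trans (sym (translate-inverse d f)) (trans (d⁻.⟦⟧-cong p) d⁻.0#-homo))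
      where module d⁻ = RingMorphisms.IsRingHomomorphism (translate-isHom (λ i → K.- d i))

-- The field of rational functions K(z₀,…,z_{N-1}), with its multiplication
-- and translations; addition of rational functions is not needed below.
module RationalFunctions {c ℓ₁ ℓ₂} (𝕂 : HeytingField c ℓ₁ ℓ₂) (N : ℕ) where
  private
    module 𝕂 = HeytingField 𝕂
    K : CommutativeRing c ℓ₁
    K = HeytingCommutativeRing.commutativeRing 𝕂.heytingCommutativeRing
    module K = CommutativeRing K
    module M = Multivariate K

  open CommutativeRing (M.Poly N) public
    using () renaming
    ( Carrier to Polynomial; _≈_ to _≈ₚ_; _+_ to _+ₚ_; _-_ to _-ₚ_; _*_ to _*ₚ_; 0# to 0ₚ; 1# to 1ₚ )
  private module P = CommutativeRing (M.Poly N)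

  const : 𝕂.Carrier → Polynomial
  const = M.const N

  var : Fin N → Polynomial
  var = M.var N

  1≉0 : ¬ 𝕂.1# 𝕂.≈ 𝕂.0#
  1≉0 p = 𝕂.#-irrefl p (HeytingProperties.1#0 𝕂.heytingCommutativeRing)

  𝕂-stable : StableEquality K
  𝕂-stable {x} {y} p = proj₁ (𝕂.tight x y) λ x#y → p λ x≈y → 𝕂.#-irrefl x≈y x#y

  𝕂-noZeroDivisors : NoZeroDivisors K
  𝕂-noZeroDivisors {x} {y} x≉0 y≉0 xy≈0 = x≉0 (proj₁ (𝕂.tight x 𝕂.0#) λ x#0 → cancel (𝕂.#⇒invertible x#0))
    where
    open SetoidReasoning K.setoid
    cancel : _ → ⊥
    cancel (u , u*x≈1 , _) = y≉0 (begin
      y                       ≈⟨ K.*-identityˡ y ⟨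
      K.1# K.* y              ≈⟨ K.*-congʳ u*x≈1 ⟨
      (u K.* (x K.- K.0#)) K.* y ≈⟨ K.*-congʳ (K.*-congˡ (HeytingProperties.x-0≈x 𝕂.heytingCommutativeRing x)) ⟩
      (u K.* x) K.* y         ≈⟨ K.*-assoc _ _ _ ⟩
      u K.* (x K.* y)         ≈⟨ K.*-congˡ xy≈0 ⟩
      u K.* K.0#              ≈⟨ K.zeroʳ u ⟩
      K.0#                    ∎)

  *ₚ-nonzero : ∀ {f g} → ¬ f ≈ₚ 0ₚ → ¬ g ≈ₚ 0ₚ → ¬ f *ₚ g ≈ₚ 0ₚ
  *ₚ-nonzero = M.noZeroDivisors 𝕂-noZeroDivisors N

  1ₚ-nonzero : ¬ 1ₚ ≈ₚ 0ₚ
  1ₚ-nonzero p = 1≉0 (begin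
      K.1#     ≈⟨ e.1#-homo ⟨
      ev 1ₚ    ≈⟨ e.⟦⟧-cong p ⟩
      ev 0ₚ    ≈⟨ e.0#-homo ⟩
      K.0#     ∎)
    where
    open SetoidReasoning K.setoid
    ev : Polynomial → 𝕂.Carrier
    ev = M.eval K id N (λ _ → K.0#)
    module e = RingMorphisms.IsRingHomomorphism (M.eval-isHom K id (M.const-isHom 0) N (λ _ → K.0#))

  record RatFun : Set (c ⊔ ℓ₁) where
    constructor _/_[_]
    field
      num         : Polynomial
      den         : Polynomial
      den-nonzero : ¬ den ≈ₚ 0ₚ
  open RatFun public

  infix 4 _≃_
  data _≃_ (f g : RatFun) : Set ℓ₁ where
    *≈* : num f *ₚ den g ≈ₚ num g *ₚ den f → f ≃ g

  infixl 7 _*_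
  _*_ : RatFun → RatFun → RatFun
  f * g = (num f *ₚ num g) / (den f *ₚ den g) [ *ₚ-nonzero (den-nonzero f) (den-nonzero g) ]

  fromPolynomial : Polynomial → RatFun
  fromPolynomial f = f / 1ₚ [ 1ₚ-nonzero ]

  1ᵣ : RatFun
  1ᵣ = fromPolynomial 1ₚ

  translate : Vector 𝕂.Carrier N → RatFun → RatFun
  translate d f = M.translate N d (num f) / M.translate N d (den f) [ M.translate-nonzero N d (den-nonzero f) ]

  ≃-isEquivalence : IsEquivalence _≃_
  ≃-isEquivalence = record { refl = *≈* P.refl ; sym = λ { (*≈* p) → *≈* (P.sym p) } ; trans = ≃-trans }
    where
    open SetoidReasoning P.setoid
    open RingProperties P.ring using (x∙y⁻¹≈ε⇒x≈y; [y-z]x≈yx-zx)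
    open CommutativeSemigroupProperties P.*-commutativeSemigroup using (xy∙z≈xz∙y)

    cancelʳ : ∀ {d} f g → ¬ d ≈ₚ 0ₚ → f *ₚ d ≈ₚ g *ₚ d → f ≈ₚ g
    cancelʳ {d} f g d≉0 p = M.stableEquality 𝕂-stable N λ f≉g →
      *ₚ-nonzero (λ q → f≉g (x∙y⁻¹≈ε⇒x≈y f g q)) d≉0 (begin
        (f -ₚ g) *ₚ d      ≈⟨ [y-z]x≈yx-zx d f g ⟩
        f *ₚ d -ₚ g *ₚ d   ≈⟨ P.+-congʳ p ⟩
        g *ₚ d -ₚ g *ₚ d   ≈⟨ P.-‿inverseʳ _ ⟩
        0ₚ                 ∎)

    ≃-trans : ∀ {f g h} → f ≃ g → g ≃ h → f ≃ h
    ≃-trans {f} {g} {h} (*≈* p) (*≈* q) = *≈* (cancelʳ _ _ (den-nonzero g) (begin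
      (num f *ₚ den h) *ₚ den g  ≈⟨ xy∙z≈xz∙y (num f) (den h) (den g) ⟩
      (num f *ₚ den g) *ₚ den h  ≈⟨ P.*-congʳ p ⟩
      (num g *ₚ den f) *ₚ den h  ≈⟨ xy∙z≈xz∙y (num g) (den f) (den h) ⟩
      (num g *ₚ den h) *ₚ den f  ≈⟨ P.*-congʳ q ⟩
      (num h *ₚ den g) *ₚ den f  ≈⟨ xy∙z≈xz∙y (num h) (den g) (den f) ⟩
      (num h *ₚ den f) *ₚ den g  ∎))

  *-commutativeMonoid : CommutativeMonoid (c ⊔ ℓ₁) ℓ₁
  *-commutativeMonoid = record
    { Carrier = RatFun ; _≈_ = _≃_ ; _∙_ = _*_ ; ε = 1ᵣ
    ; isCommutativeMonoid = record
      { isMonoid = record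
        { isSemigroup = record
          { isMagma = record
            { isEquivalence = ≃-isEquivalence
            ; ∙-cong = λ { {f} {f′} {g} {g′} (*≈* p) (*≈* q) → *≈* (P.trans (interchange (num f) (num g) (den f′) (den g′))
                (P.trans (P.*-cong p q) (interchange (num f′) (den f) (num g′) (den g)))) }
            }
          ; assoc = λ f g h → *≈* (P.*-cong (P.*-assoc _ _ _) (P.sym (P.*-assoc _ _ _)))
          }
        ; identity = (λ f → *≈* (P.*-cong (P.*-identityˡ _) (P.sym (P.*-identityˡ _))))
                   , (λ f → *≈* (P.*-cong (P.*-identityʳ _) (P.sym (P.*-identityʳ _))))
        }
      ; comm = λ f g → *≈* (P.*-cong (P.*-comm _ _) (P.*-comm _ _))
      }
    }
    where open CommutativeSemigroupProperties P.*-commutativeSemigroup using (interchange)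

  open RawMonoidDefinitions (CommutativeMonoid.rawMonoid *-commutativeMonoid) public
    using () renaming (sum to ∏)

  ∏≢ : ∀ {k} (l : Fin k) → (∀ j → j ≢ l → RatFun) → RatFun
  ∏≢ l f = ∏ factor
    where
    factor : Vector RatFun _
    factor j with j ≟ l
    ... | yes _  = 1ᵣ
    ... | no j≢l = f j j≢l

  -- z_u - z_v + d is a nonzero polynomial: its values at z = e_u and z = 0 differ by 1.
  linear-nonzero : ∀ {u v} d → u ≢ v → ¬ (var u -ₚ var v) +ₚ const d ≈ₚ 0ₚ
  linear-nonzero {u} {v} d u≢v p = 1≉0 (+-cancelʳ d K.1# K.0# (K.trans (K.sym at-e_u) (K.trans (value δ) (K.trans (K.sym (value (λ _ → K.0#))) at-0))))
    where
    open RingProperties K.ring using (+-cancelʳ; -0#≈0#)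

    δ : Vector 𝕂.Carrier N
    δ i with i ≟ u
    ... | yes _ = K.1#
    ... | no  _ = K.0#

    δu : δ u K.≈ K.1#
    δu with u ≟ u
    ... | yes _  = K.refl
    ... | no u≢u = contradiction ≡.refl u≢u

    δv : δ v K.≈ K.0#
    δv with v ≟ u
    ... | yes v≡u = contradiction (≡.sym v≡u) u≢v
    ... | no  _   = K.refl

    module _ (z : Vector 𝕂.Carrier N) where
      ev : Polynomial → 𝕂.Carrier
      ev = M.eval K id N z
      module e = RingMorphisms.IsRingHomomorphism (M.eval-isHom K id (M.const-isHom 0) N z)

      expand : ev ((var u -ₚ var v) +ₚ const d) K.≈ (z u K.- z v) K.+ d
      expand = K.trans (e.+-homo _ _) (K.+-cong
        (K.trans (e.+-homo _ _) (K.+-cong (M.eval-var K id (M.const-isHom 0) N z u)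
          (K.trans (e.-‿homo _) (K.-‿cong (M.eval-var K id (M.const-isHom 0) N z v)))))
        (M.eval-const K id (M.const-isHom 0) N z d))

      value : (z u K.- z v) K.+ d K.≈ K.0#
      value = K.trans (K.sym expand) (K.trans (e.⟦⟧-cong p) e.0#-homo)

    at-e_u : (δ u K.- δ v) K.+ d K.≈ K.1# K.+ d
    at-e_u = K.+-congʳ (K.trans (K.+-cong δu (K.trans (K.-‿cong δv) -0#≈0#)) (K.+-identityʳ _))

    at-0 : (K.0# K.- K.0#) K.+ d K.≈ K.0# K.+ d
    at-0 = K.+-congʳ (K.-‿inverseʳ K.0#)

-- The kernel of ℤ → 𝕂 is pℤ.
HasCharacteristic : ∀ {c ℓ₁ ℓ₂} → HeytingField c ℓ₁ ℓ₂ → ℕ → Set ℓ₁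
HasCharacteristic 𝕂 p = ∀ k → (k ×ₖ 1# ≈ 0#) ⇔ (p ∣ k)
  where
  open HeytingField 𝕂 using (heytingCommutativeRing; _≈_; 0#; 1#)
  open CommutativeRing (HeytingCommutativeRing.commutativeRing heytingCommutativeRing) using (+-rawMonoid)
  open RawMonoidDefinitions +-rawMonoid using () renaming (_×_ to _×ₖ_)

module PCurvature {c ℓ₁ ℓ₂} (𝕂 : HeytingField c ℓ₁ ℓ₂) (p n r : ℕ)
                  (a κ : HeytingField.Carrier 𝕂) (Λ : Vector (HeytingField.Carrier 𝕂) n) where
  private
    module 𝕂 = HeytingField 𝕂
    K : CommutativeRing c ℓ₁
    K = HeytingCommutativeRing.commutativeRing 𝕂.heytingCommutativeRing

  open RawMonoidDefinitions (CommutativeRing.+-rawMonoid K) using () renaming (_×_ to _×ₖ_)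
  -- The variables are ordered s₁,…,s_r,x₁,…,x_n.
  open RationalFunctions 𝕂 (r +ℕ n) public

  s-index : Fin r → Fin (r +ℕ n)
  s-index l = l ↑ˡ n

  x-index : Fin n → Fin (r +ℕ n)
  x-index m = r ↑ʳ m

  s : Fin r → Polynomial
  s l = var (s-index l)

  x : Fin n → Polynomial
  x m = var (x-index m)

  infix 8 _·e_
  _·e_ : 𝕂.Carrier → Fin (r +ℕ n) → Vector 𝕂.Carrier (r +ℕ n)
  (d ·e u) v with v ≟ u
  ... | yes _ = d
  ... | no  _ = 𝕂.0#

  -- f(s,x) ↦ f(s + d e_l, x) and f(s,x) ↦ f(s, x + d f_m)
  shift-s : Fin r → 𝕂.Carrier → RatFun → RatFun
  shift-s l d = translate (d ·e s-index l)

  shift-x : Fin n → 𝕂.Carrier → RatFun → RatFun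
  shift-x m d = translate (d ·e x-index m)

  s≢x : ∀ l m → s-index l ≢ x-index m
  s≢x l m p with ≡.trans (≡.sym (splitAt-↑ˡ r l n)) (≡.trans (≡.cong (splitAt r) p) (splitAt-↑ʳ r n m))
  ... | ()

  s≢s : ∀ {j l} → j ≢ l → s-index l ≢ s-index j
  s≢s j≢l p = j≢l (≡.sym (↑ˡ-injective n _ _ p))

  private
    module P = CommutativeRing (Multivariate.Poly K (r +ℕ n))
    module C = RingMorphisms.IsRingHomomorphism (Multivariate.const-isHom K (r +ℕ n))

  sx-nonzero : ∀ l m d → ¬ s l -ₚ x m +ₚ const d ≈ₚ 0ₚ
  sx-nonzero l m d = linear-nonzero d (s≢x l m)

  sx-nonzero₂ : ∀ l m d e → ¬ s l -ₚ x m +ₚ const d -ₚ const e ≈ₚ 0ₚ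
  sx-nonzero₂ l m d e p = sx-nonzero l m (d 𝕂.- e) (P.trans (P.trans
    (P.+-congˡ (P.trans (C.+-homo _ _) (P.+-congˡ (C.-‿homo _)))) (P.sym (P.+-assoc _ _ _))) p)

  ss-nonzero₀ : ∀ {j l} → j ≢ l → ¬ s l -ₚ s j ≈ₚ 0ₚ
  ss-nonzero₀ j≢l p = linear-nonzero 𝕂.0# (s≢s j≢l) (P.trans (P.+-congˡ C.0#-homo) (P.trans (P.+-identityʳ _) p))

  ss-nonzero₂ : ∀ {j l} → j ≢ l → ∀ d e → ¬ s l -ₚ s j +ₚ const d +ₚ const e ≈ₚ 0ₚ
  ss-nonzero₂ j≢l d e p = linear-nonzero (d 𝕂.+ e) (s≢s j≢l)
    (P.trans (P.trans (P.+-congˡ (C.+-homo _ _)) (P.sym (P.+-assoc _ _ _))) p)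

  Φ : Fin r → RatFun
  Φ l = fromPolynomial (const κ)
      * ∏ (λ i → (s l -ₚ x i +ₚ const (Λ i)) / (s l -ₚ x i +ₚ const a) [ sx-nonzero l i a ])
      * ∏≢ l (λ j j≢l →
          ((s l -ₚ s j +ₚ const a) *ₚ (s l -ₚ s j -ₚ const 𝕂.1#))
          / ((s l -ₚ s j) *ₚ (s l -ₚ s j +ₚ const 𝕂.1# +ₚ const a))
          [ *ₚ-nonzero (ss-nonzero₀ j≢l) (ss-nonzero₂ j≢l 𝕂.1# a) ])

  Ψ : Fin n → RatFun
  Ψ m = ∏ (λ j → (s j -ₚ x m) / (s j -ₚ x m +ₚ const (Λ m) -ₚ const a) [ sx-nonzero₂ j m (Λ m) a ])

  Φ̃ : Fin r → RatFun
  Φ̃ l = ∏ {p} (λ i → shift-s l (toℕ i ×ₖ a) (Φ l))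

  Ψ̃ : Fin n → RatFun
  Ψ̃ m = ∏ {p} (λ i → shift-x m (toℕ i ×ₖ a) (Ψ m))

  Periodic : RatFun → Set ℓ₁
  Periodic f = (∀ k → shift-s k a f ≃ f) × (∀ k → shift-x k a f ≃ f)

{-# OPTIONS --safe #-}

-- For a rational function f put N_u f = ∏_{i<p} f(z + i a e_u), so that Φ̃ and Ψ̃ are
-- N_u Φ and N_u Ψ.  Since p a = 0, translation by a e_u permutes the factors of N_u f cyclically.
-- As N_u is multiplicative, for a shift of z_v with v ≠ u it suffices to treat a single factor f of
-- Φ or Ψ, and such an f depends only on the difference z_u − z_w for some w.  If v ≠ w then f does
-- not involve z_v.  If v = w then f is invariant under a (e_u + e_v), so translating N_u f by a e_v
-- is the same as translating it by − a e_u.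
module Submission where

open import Defs
open import Algebra.Apartness.Bundles using (HeytingField; HeytingCommutativeRing)
open import Algebra.Bundles using (CommutativeMonoid; CommutativeRing)
import Algebra.Definitions.RawMonoid as RawMonoidDefinitions
import Algebra.Morphism.Construct.Composition as Composition
open import Algebra.Morphism.Structures using (module RingMorphisms)
import Algebra.Properties.CommutativeMonoid.Sum as CommutativeMonoidSum
import Algebra.Properties.Semiring.Mult as SemiringMult
open import Data.Fin.Base using (Fin; zero; suc; toℕ; inject₁; fromℕ)
open import Data.Fin.Properties using (_≟_; toℕ-inject₁; toℕ-fromℕ)
open import Data.Nat.Base using (ℕ; zero; suc; _≤_; _<_) renaming (_+_ to _+ℕ_)
open import Data.Nat.Divisibility using (∣-refl)
open import Data.Product.Base using (Σ; _×_; _,_; proj₁)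
open import Data.Vec.Functional using (Vector)
open import Function.Base using (_∘_)
open import Function.Bundles using (Equivalence)
open import Level using (_⊔_)
open import Relation.Binary.PropositionalEquality as ≡ using (_≡_; _≢_)
import Relation.Binary.Reasoning.Setoid as SetoidReasoning
open import Relation.Nullary.Decidable.Core using (yes; no)
open import Relation.Nullary.Negation.Core using (contradiction)

-- Cyclic reindexing of finite products.

module _ {c ℓ} (M : CommutativeMonoid c ℓ) where
  open CommutativeMonoid M
  open CommutativeMonoidSum M using (sum; sum-init-last; sum-cong-≗)

  -- The two sums share all terms except the last on the left, `g n`, and the first on the right,
  -- `g 0`, which agree by hypothesis.
  sum-rotate : ∀ n (g : ℕ → Carrier) → g n ≈ g 0 →
               sum {n} (λ i → g (suc (toℕ i))) ≈ sum {n} (λ i → g (toℕ i))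
  sum-rotate zero    g gn≈g0 = refl
  sum-rotate (suc n) g gn≈g0 = begin
    sum {suc n} (λ i → g (suc (toℕ i)))
      ≈⟨ sum-init-last (λ i → g (suc (toℕ i))) ⟩
    sum {n} (λ i → g (suc (toℕ (inject₁ i)))) ∙ g (suc (toℕ (fromℕ n)))
      ≡⟨ ≡.cong₂ _∙_ (sum-cong-≗ {n} (λ i → ≡.cong (g ∘ suc) (toℕ-inject₁ i))) (≡.cong (g ∘ suc) (toℕ-fromℕ n)) ⟩
    sum {n} (λ i → g (suc (toℕ i))) ∙ g (suc n)
      ≈⟨ comm _ _ ⟩
    g (suc n) ∙ sum {n} (λ i → g (suc (toℕ i)))
      ≈⟨ ∙-congʳ gn≈g0 ⟩
    sum {suc n} (λ i → g (toℕ i)) ∎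
    where open SetoidReasoning setoid

-- Composition of translations and invariant polynomials.

module PolynomialTranslation {c ℓ} (K : CommutativeRing c ℓ) (N : ℕ) where
  private
    module K = CommutativeRing K
    module C = RingMorphisms.IsRingHomomorphism (Multivariate.const-isHom K N)
    module T d = RingMorphisms.IsRingHomomorphism (Multivariate.translate-isHom K N d)
  open Multivariate K using (Poly; const; var; translate; translate-isHom; translate-const; translate-var; eval-unique)
  open CommutativeRing (Poly N)

  translate-congˡ : ∀ {d e} → (∀ i → d i K.≈ e i) → ∀ f → translate N d f ≈ translate N e f
  translate-congˡ {d} {e} d≈e =
    eval-unique (Poly N) (const N) N _ (translate N d) (translate-isHom N d) (translate-const N d)
      (λ i → trans (translate-var N d i) (+-congˡ (C.⟦⟧-cong (d≈e i))))

  -- A ring homomorphism out of the polynomial ring is determined by its values on constants and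
  -- variables, so it suffices to compare the two sides there.
  translate-∘ : ∀ d e f → translate N d (translate N e f) ≈ translate N (λ i → d i K.+ e i) f
  translate-∘ d e =
    eval-unique (Poly N) (const N) N _ (translate N d ∘ translate N e)
      (Composition.isRingHomomorphism trans (translate-isHom N e) (translate-isHom N d))
      (λ b → trans (T.⟦⟧-cong d (translate-const N e b)) (translate-const N d b))
      on-var
    where
    open SetoidReasoning setoid
    on-var : ∀ i → translate N d (translate N e (var N i)) ≈ var N i + const N (d i K.+ e i)
    on-var i = begin
      translate N d (translate N e (var N i))                  ≈⟨ T.⟦⟧-cong d (translate-var N e i) ⟩
      translate N d (var N i + const N (e i))                  ≈⟨ T.+-homo d _ _ ⟩
      translate N d (var N i) + translate N d (const N (e i))  ≈⟨ +-cong (translate-var N d i) (translate-const N d (e i)) ⟩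
      (var N i + const N (d i)) + const N (e i)                ≈⟨ +-assoc _ _ _ ⟩
      var N i + (const N (d i) + const N (e i))                ≈⟨ +-congˡ (C.+-homo _ _) ⟨
      var N i + const N (d i K.+ e i)                          ∎

  -- A record rather than a bare equation, so that `d` and `f` can be inferred from the type when
  -- the closure rules are combined.
  record Invariant (d : Vector K.Carrier N) (f : Carrier) : Set ℓ where
    constructor invariant
    field fixed : translate N d f ≈ f
  open Invariant public

  module _ {d : Vector K.Carrier N} where

    invariant-const : ∀ b → Invariant d (const N b)
    invariant-const b = invariant (translate-const N d b)

    invariant-1 : Invariant d 1#
    invariant-1 = invariant (T.1#-homo d)

    invariant-+ : ∀ {f g} → Invariant d f → Invariant d g → Invariant d (f + g)
    invariant-+ p q = invariant (trans (T.+-homo d _ _) (+-cong (fixed p) (fixed q)))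

    invariant-neg : ∀ {f} → Invariant d f → Invariant d (- f)
    invariant-neg p = invariant (trans (T.-‿homo d _) (-‿cong (fixed p)))

    invariant-* : ∀ {f g} → Invariant d f → Invariant d g → Invariant d (f * g)
    invariant-* p q = invariant (trans (T.*-homo d _ _) (*-cong (fixed p) (fixed q)))

    -- Both variables move by the same constant, which cancels in the difference.
    invariant-difference : ∀ u w → d u K.≈ d w → Invariant d (var N u - var N w)
    invariant-difference u w du≈dw = invariant (begin
      translate N d (var N u - var N w)
        ≈⟨ trans (T.+-homo d _ _) (+-congˡ (T.-‿homo d _)) ⟩
      translate N d (var N u) - translate N d (var N w)
        ≈⟨ +-cong (translate-var N d u) (-‿cong (translate-var N d w)) ⟩
      (var N u + const N (d u)) - (var N w + const N (d w))
        ≈⟨ +-congˡ (-‿cong (+-congˡ (C.⟦⟧-cong du≈dw))) ⟨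
      (var N u + const N (d u)) - (var N w + const N (d u))
        ≈⟨ +-congˡ (⁻¹-∙-comm (var N w) (const N (d u))) ⟨
      (var N u + const N (d u)) + (- var N w - const N (d u))
        ≈⟨ interchange _ _ _ _ ⟩
      (var N u - var N w) + (const N (d u) - const N (d u))
        ≈⟨ +-congˡ (-‿inverseʳ _) ⟩
      (var N u - var N w) + 0#
        ≈⟨ +-identityʳ _ ⟩
      var N u - var N w ∎)
      where
      open SetoidReasoning setoid
      open import Algebra.Properties.AbelianGroup +-abelianGroup using (⁻¹-∙-comm)
      open import Algebra.Properties.CommutativeSemigroup +-commutativeSemigroup using (interchange)

-- Translations of rational functions and properties closed under products.

module RationalTranslation {c ℓ₁ ℓ₂} (𝕂 : HeytingField c ℓ₁ ℓ₂) (N : ℕ) where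
  private
    module 𝕂 = HeytingField 𝕂
    K : CommutativeRing c ℓ₁
    K = HeytingCommutativeRing.commutativeRing 𝕂.heytingCommutativeRing
    module P = CommutativeRing (Multivariate.Poly K N)
    module T d = RingMorphisms.IsRingHomomorphism (Multivariate.translate-isHom K N d)
    module PT = PolynomialTranslation K N
  open RationalFunctions 𝕂 N
  open CommutativeMonoid *-commutativeMonoid using (refl; sym; trans; ∙-cong)

  fraction-cong : ∀ {f g} → num f ≈ₚ num g → den f ≈ₚ den g → f ≃ g
  fraction-cong p q = *≈* (P.*-cong p (P.sym q))

  fraction-invariant : ∀ {d f} → PT.Invariant d (num f) → PT.Invariant d (den f) → translate d f ≃ f
  fraction-invariant p q = fraction-cong (PT.fixed p) (PT.fixed q)

  -- Translation is a ring homomorphism, so it carries the cross-multiplied identity for `f` and `g`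
  -- to the one for their translates.
  translate-congʳ : ∀ d {f g} → f ≃ g → translate d f ≃ translate d g
  translate-congʳ d (*≈* p) = *≈* (P.trans (P.sym (T.*-homo d _ _)) (P.trans (T.⟦⟧-cong d p) (T.*-homo d _ _)))

  translate-congˡ : ∀ {d e} → (∀ i → d i 𝕂.≈ e i) → ∀ f → translate d f ≃ translate e f
  translate-congˡ d≈e f = fraction-cong (PT.translate-congˡ d≈e (num f)) (PT.translate-congˡ d≈e (den f))

  translate-∘ : ∀ d e f → translate d (translate e f) ≃ translate (λ i → d i 𝕂.+ e i) f
  translate-∘ d e f = fraction-cong (PT.translate-∘ d e (num f)) (PT.translate-∘ d e (den f))

  translate-comm : ∀ d e f → translate d (translate e f) ≃ translate e (translate d f)
  translate-comm d e f = trans (translate-∘ d e f)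
    (trans (translate-congˡ (λ i → 𝕂.+-comm (d i) (e i)) f) (sym (translate-∘ e d f)))

  translate-* : ∀ d f g → translate d (f * g) ≃ translate d f * translate d g
  translate-* d f g = fraction-cong (T.*-homo d _ _) (T.*-homo d _ _)

  translate-1 : ∀ d → translate d 1ᵣ ≃ 1ᵣ
  translate-1 d = fraction-cong (T.1#-homo d) (T.1#-homo d)

  translate-∏ : ∀ d {k} (f : Vector RatFun k) → translate d (∏ f) ≃ ∏ (λ i → translate d (f i))
  translate-∏ d {zero}  f = translate-1 d
  translate-∏ d {suc k} f = trans (translate-* d (f zero) (∏ (f ∘ suc))) (∙-cong (refl {translate d (f zero)}) (translate-∏ d (f ∘ suc)))

  module _ {ℓ} (Q : RatFun → Set ℓ) (Q-1 : Q 1ᵣ) (Q-* : ∀ {f g} → Q f → Q g → Q (f * g)) where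

    ∏-closed : ∀ {k} (f : Vector RatFun k) → (∀ i → Q (f i)) → Q (∏ f)
    ∏-closed {zero}  f q = Q-1
    ∏-closed {suc k} f q = Q-* (q zero) (∏-closed (f ∘ suc) (q ∘ suc))

    ∏≢-closed : ∀ {k} (l : Fin k) (f : ∀ j → j ≢ l → RatFun) → (∀ j j≢l → Q (f j j≢l)) → Q (∏≢ l f)
    ∏≢-closed l f q = ∏-closed (proj₁ (factors l f)) go
      where
      -- Recovers the factors of ∏≢, which are local to its definition.
      factors : ∀ {k} (l : Fin k) (f : ∀ j → j ≢ l → RatFun) → Σ (Vector RatFun k) λ g → ∏≢ l f ≡ ∏ g
      factors l f = _ , ≡.refl

      go : ∀ j → Q (proj₁ (factors l f) j)
      -- Repeating the case split made in `∏≢` lets the recovered factor compute to `1ᵣ` or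
      -- `f j j≢l`.
      go j with j ≟ l
      ... | yes _  = Q-1
      ... | no j≢l = q j j≢l

-- Norms along one variable and their periodicity.

module Periodicity {c ℓ₁ ℓ₂} (𝕂 : HeytingField c ℓ₁ ℓ₂) (p : ℕ) (char : HasCharacteristic 𝕂 p) (n r : ℕ)
                   (a κ : HeytingField.Carrier 𝕂) (Λ : Vector (HeytingField.Carrier 𝕂) n) where
  private
    module 𝕂 = HeytingField 𝕂
    K : CommutativeRing c ℓ₁
    K = HeytingCommutativeRing.commutativeRing 𝕂.heytingCommutativeRing
    module K = CommutativeRing K
  open RawMonoidDefinitions K.+-rawMonoid using () renaming (_×_ to _×ₖ_)
  open SemiringMult K.semiring using (×-congʳ; ×-assoc-*)
  open PCurvature 𝕂 p n r a κ Λ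
  open PolynomialTranslation K (r +ℕ n)
    using (invariant-const; invariant-1; invariant-+; invariant-neg; invariant-*; invariant-difference)
  open RationalTranslation 𝕂 (r +ℕ n)
  open CommutativeMonoid *-commutativeMonoid using (setoid; trans; ∙-cong)
  open CommutativeMonoidSum *-commutativeMonoid using (sum-cong-≋; ∑-distrib-+)
  open SetoidReasoning setoid

  -- The multiple `p ×ₖ b` equals `(p ×ₖ 1) b`, and `p ×ₖ 1` vanishes because `p` divides itself.
  p×≈0 : ∀ b → p ×ₖ b K.≈ K.0#
  p×≈0 b = K.trans (×-congʳ p (K.sym (K.*-identityˡ b))) (K.trans (K.sym (×-assoc-* p K.1# b))
    (K.trans (K.*-congʳ (Equivalence.from (char p) ∣-refl)) (K.zeroˡ b)))

  ·e-same : ∀ d u → (d ·e u) u ≡ d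
  ·e-same d u with u ≟ u
  ... | yes _  = ≡.refl
  ... | no u≢u = contradiction ≡.refl u≢u

  ·e-other : ∀ d {u v} → v ≢ u → (d ·e u) v ≡ 𝕂.0#
  ·e-other d {u} {v} v≢u with v ≟ u
  ... | yes v≡u = contradiction v≡u v≢u
  ... | no  _   = ≡.refl

  ·e-cong : ∀ {d e} u → d K.≈ e → ∀ v → (d ·e u) v K.≈ (e ·e u) v
  ·e-cong u d≈e v with v ≟ u
  ... | yes _ = d≈e
  ... | no  _ = K.refl

  ·e-+ : ∀ d e u v → (d ·e u) v K.+ (e ·e u) v K.≈ ((d K.+ e) ·e u) v
  ·e-+ d e u v with v ≟ u
  ... | yes _ = K.refl
  ... | no  _ = K.+-identityˡ _

  -- This is N_u. At `s-index l` and `Φ l` it unfolds to `Φ̃ l`, and at `x-index m` and `Ψ m` to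
  -- `Ψ̃ m`.
  norm : Fin (r +ℕ n) → RatFun → RatFun
  norm u f = ∏ {p} (λ i → translate ((toℕ i ×ₖ a) ·e u) f)

  norm-cong : ∀ u {f g} → f ≃ g → norm u f ≃ norm u g
  norm-cong u f≃g = sum-cong-≋ {p} (λ i → translate-congʳ _ f≃g)

  norm-* : ∀ u f g → norm u (f * g) ≃ norm u f * norm u g
  norm-* u f g = trans (sum-cong-≋ {p} (λ i → translate-* _ f g)) (∑-distrib-+ {p} _ _)

  translate-norm : ∀ d u f → translate d (norm u f) ≃ norm u (translate d f)
  translate-norm d u f = trans (translate-∏ d {p} _) (sum-cong-≋ {p} (λ i → translate-comm d _ f))

  norm-periodic-same : ∀ u f → translate (a ·e u) (norm u f) ≃ norm u f
  norm-periodic-same u f = begin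
    translate (a ·e u) (norm u f)
      ≈⟨ translate-∏ (a ·e u) {p} _ ⟩
    ∏ {p} (λ i → translate (a ·e u) (translate ((toℕ i ×ₖ a) ·e u) f))
      -- The shifts `a` and `i a` add up to `(i + 1) a`, so every factor moves on by one place.
      ≈⟨ sum-cong-≋ {p} (λ i → trans (translate-∘ _ _ f) (translate-congˡ (·e-+ a (toℕ i ×ₖ a) u) f)) ⟩
    ∏ {p} (λ i → translate ((suc (toℕ i) ×ₖ a) ·e u) f)
      -- The cycle closes because `p a` and `0 a` are both zero.
      ≈⟨ sum-rotate *-commutativeMonoid p (λ i → translate ((i ×ₖ a) ·e u) f)
           (translate-congˡ (·e-cong u (p×≈0 a)) f) ⟩
    norm u f ∎

  record NormPeriodic (u v : Fin (r +ℕ n)) (f : RatFun) : Set ℓ₁ where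
    constructor normPeriodic
    field periodic : translate (a ·e v) (norm u f) ≃ norm u f
  open NormPeriodic public

  module _ {u v : Fin (r +ℕ n)} where

    -- Translations commute, so the shift of the norm is the norm of the shifted function.
    normPeriodic-invariant : ∀ {f} → translate (a ·e v) f ≃ f → NormPeriodic u v f
    normPeriodic-invariant {f} f-inv = normPeriodic (trans (translate-norm (a ·e v) u f) (norm-cong u f-inv))

    normPeriodic-invariant₂ : ∀ {f} → translate (λ i → (a ·e v) i 𝕂.+ (a ·e u) i) f ≃ f → NormPeriodic u v f
    normPeriodic-invariant₂ {f} f-inv = normPeriodic (begin
      translate (a ·e v) (norm u f)
        -- The norm absorbs a shift by `a` along `u`; inserting one turns the shift along `v` into
        -- the diagonal shift that fixes `f`.
        ≈⟨ translate-congʳ (a ·e v) (norm-periodic-same u f) ⟨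
      translate (a ·e v) (translate (a ·e u) (norm u f))
        ≈⟨ translate-∘ (a ·e v) (a ·e u) (norm u f) ⟩
      translate (λ i → (a ·e v) i 𝕂.+ (a ·e u) i) (norm u f)
        ≈⟨ translate-norm _ u f ⟩
      norm u (translate (λ i → (a ·e v) i 𝕂.+ (a ·e u) i) f)
        ≈⟨ norm-cong u f-inv ⟩
      norm u f ∎)

    normPeriodic-1 : NormPeriodic u v 1ᵣ
    normPeriodic-1 = normPeriodic-invariant (translate-1 _)

    normPeriodic-* : ∀ {f g} → NormPeriodic u v f → NormPeriodic u v g → NormPeriodic u v (f * g)
    normPeriodic-* {f} {g} f-per g-per = normPeriodic (begin
      translate (a ·e v) (norm u (f * g))                        ≈⟨ translate-congʳ _ (norm-* u f g) ⟩
      translate (a ·e v) (norm u f * norm u g)                   ≈⟨ translate-* _ (norm u f) (norm u g) ⟩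
      translate (a ·e v) (norm u f) * translate (a ·e v) (norm u g) ≈⟨ ∙-cong (periodic f-per) (periodic g-per) ⟩
      norm u f * norm u g                                        ≈⟨ norm-* u f g ⟨
      norm u (f * g)                                             ∎)

  -- Each side is the sum of one `a` and one zero, in opposite orders.
  e+e-agree : ∀ {u w} → u ≢ w → (a ·e w) u K.+ (a ·e u) u K.≈ (a ·e w) w K.+ (a ·e u) w
  e+e-agree {u} {w} u≢w = K.trans
    (K.reflexive (≡.cong₂ K._+_ (·e-other a u≢w) (·e-same a u)))
    (K.trans (K.+-comm K.0# a)
      (K.reflexive (≡.sym (≡.cong₂ K._+_ (·e-same a w) (·e-other a (u≢w ∘ ≡.sym))))))

  -- Dependence on z_u - z_w alone is expressed through invariance: every translation moving z_u and
  -- z_w equally fixes `f`, however it moves the other variables.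
  DependsOnDifference : Fin (r +ℕ n) → Fin (r +ℕ n) → RatFun → Set (c ⊔ ℓ₁)
  DependsOnDifference u w f = ∀ d → d u K.≈ d w → translate d f ≃ f

  normPeriodic-difference : ∀ {u w} v {f} → u ≢ w → DependsOnDifference u w f → NormPeriodic u v f
  normPeriodic-difference {u} {w} v {f} u≢w f-diff with v ≟ u | v ≟ w
  ... | yes ≡.refl | _          = normPeriodic (norm-periodic-same u f)
  ... | no  _      | yes ≡.refl = normPeriodic-invariant₂ (f-diff _ (e+e-agree u≢w))
  -- Here `a ·e v` vanishes at both `u` and `w`.
  ... | no  v≢u    | no  v≢w    = normPeriodic-invariant (f-diff (a ·e v)
    (K.reflexive (≡.trans (·e-other a (v≢u ∘ ≡.sym)) (≡.sym (·e-other a (v≢w ∘ ≡.sym))))))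

  -- Application to the factors of Φ and Ψ.

  Φ-normPeriodic : ∀ l v → NormPeriodic (s-index l) v (Φ l)
  Φ-normPeriodic l v = normPeriodic-*
    (normPeriodic-* {f = fromPolynomial (const κ)}
      (normPeriodic-invariant (fraction-invariant (invariant-const κ) invariant-1))
      (∏-closed (NormPeriodic (s-index l) v) normPeriodic-1 normPeriodic-* _ λ i →
        normPeriodic-difference v (s≢x l i) λ d eq →
          let inv = invariant-difference _ _ eq in
          fraction-invariant (invariant-+ inv (invariant-const (Λ i))) (invariant-+ inv (invariant-const a))))
    (∏≢-closed (NormPeriodic (s-index l) v) normPeriodic-1 normPeriodic-* l _ λ j j≢l →
      normPeriodic-difference v (s≢s j≢l) λ d eq →
        let inv = invariant-difference _ _ eq in
        fraction-invariant
          (invariant-* (invariant-+ inv (invariant-const a)) (invariant-+ inv (invariant-neg (invariant-const 𝕂.1#))))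
          (invariant-* inv (invariant-+ (invariant-+ inv (invariant-const 𝕂.1#)) (invariant-const a))))

  Ψ-normPeriodic : ∀ m v → NormPeriodic (x-index m) v (Ψ m)
  Ψ-normPeriodic m v = ∏-closed (NormPeriodic (x-index m) v) normPeriodic-1 normPeriodic-* _ λ j →
    normPeriodic-difference v (s≢x j m ∘ ≡.sym) λ d eq →
      -- The norm is taken along x_m, which is the subtracted variable in s_j - x_m, so the equality
      -- of shifts is reversed.
      let inv = invariant-difference _ _ (K.sym eq) in
      fraction-invariant inv (invariant-+ (invariant-+ inv (invariant-const (Λ m))) (invariant-neg (invariant-const a)))

  shift-periodic : ∀ {u f} → (∀ v → NormPeriodic u v f) → Periodic (norm u f)
  shift-periodic f-per = (λ k → periodic (f-per (s-index k))) , (λ k → periodic (f-per (x-index k)))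

  Φ̃-periodic : ∀ l → Periodic (Φ̃ l)
  Φ̃-periodic l = shift-periodic (Φ-normPeriodic l)

  Ψ̃-periodic : ∀ m → Periodic (Ψ̃ m)
  Ψ̃-periodic m = shift-periodic (Ψ-normPeriodic m)

lemma5p2 : ∀ {c ℓ₁ ℓ₂} (𝕂 : HeytingField c ℓ₁ ℓ₂) (p : ℕ) → HasCharacteristic 𝕂 p → 2 < p →
    (n r : ℕ) → 1 ≤ n → 1 ≤ r →
    let open HeytingField 𝕂 in
    (a κ : Carrier) → a # 0# → κ # 0# → (Λ : Vector Carrier n) →
    let open PCurvature 𝕂 p n r a κ Λ in
    (∀ l → Periodic (Φ̃ l)) × (∀ m → Periodic (Ψ̃ m))
lemma5p2 𝕂 p char _ n r _ _ a κ _ _ Λ = Φ̃-periodic , Ψ̃-periodic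
  where open Periodicity 𝕂 p char n r a κ Λ
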